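{- For any prime $p\ge5$, any integer $\alpha\ge1$ and any integer $n\ge0$, \[ b_{2}\!\left(p^{2\alpha}n+\frac{(24i+p)p^{2\alpha-1}-1}{24}\right)\equiv 0 \pmod 2 \] for each $i=1,2,\ldots,p-1$.
   Context: For a positive integer $\ell$, $b_\ell(n)$ denotes the number of $\ell$-regular partitions of $n$, i.e. partitions of $n$ having no part divisible by $\ell$; equivalently $\sum_{n\ge0}b_\ell(n)q^n=\prod_{k\ge1}\frac{1-q^{\ell k}}{1-q^k}$. -}

module Defs where

open import Data.List.Base using (List; []; _∷_; map; concatMap; filter; length; upTo)
open import Data.List.Membership.Propositional using (_∈_; find; lose)
open import Data.List.Membership.Propositional.Properties
  using (∈-map⁺; ∈-map⁻; ∈-upTo⁺; ∈-upTo⁻; ∈-concatMap⁺; ∈-concatMap⁻)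
open import Data.List.Properties using (∷-injectiveʳ)
open import Data.List.Relation.Binary.Disjoint.Propositional using (Disjoint)
open import Data.List.Relation.Unary.All as All using (All; []; _∷_; all?)
import Data.List.Relation.Unary.All.Properties as Allₚ
open import Data.List.Relation.Unary.AllPairs as AllPairs using ([]; _∷_)
import Data.List.Relation.Unary.AllPairs.Properties as AllPairsₚ
open import Data.List.Relation.Unary.Any using (here)
open import Data.List.Relation.Unary.Linked as Linked using (Linked; [-]; _∷_)
open import Data.List.Relation.Unary.Unique.Propositional using (Unique)
import Data.List.Relation.Unary.Unique.Propositional.Properties as Uniqueₚ
open import Data.Nat.Base
open import Data.Nat.Divisibility using (_∤_; _∣?_)
open import Data.Nat.ListAction using (sum)
open import Data.Nat.Properties
open import Data.Product.Base using (_×_; _,_)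
open import Function.Bundles using (_⇔_; mk⇔)
open import Relation.Binary.PropositionalEquality
open import Relation.Nullary.Decidable using (¬?)
open import Relation.Unary using (Decidable)

record IsPartition (n : ℕ) (ps : List ℕ) : Set where
  constructor isPartition
  field
    decreasing : Linked _≥_ ps
    positive   : All (0 <_) ps
    sums       : sum ps ≡ n

IsRegular : ℕ → List ℕ → Set
IsRegular ℓ = All (ℓ ∤_)

isRegular? : ∀ ℓ → Decidable (IsRegular ℓ)
isRegular? ℓ = all? (λ k → ¬? (ℓ ∣? k))

-- The partitions of n with all parts at most m, provided n ≤ fuel.  The fuel
-- only serves the termination checker.
partitionsUpTo : (fuel m n : ℕ) → List (List ℕ)
partitionsUpTo _          m zero    = [] ∷ []
partitionsUpTo zero       m (suc n) = []
partitionsUpTo (suc fuel) m (suc n) =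
  concatMap (λ a → map (suc a ∷_) (partitionsUpTo fuel (suc a) (n ∸ a)))
            (upTo (m ⊓ suc n))

partitions : ℕ → List (List ℕ)
partitions n = partitionsUpTo n n n

-- The number of ℓ-regular partitions of n.  That partitions n lists every
-- partition of n exactly once is ∈-partitions and partitions-unique below.
b : (ℓ n : ℕ) → ℕ
b ℓ n = length (filter (isRegular? ℓ) (partitions n))

private
  -- Linked _≥_ (m ∷ ps) says that ps is decreasing with parts at most m.
  Bounded : ℕ → ℕ → List ℕ → Set
  Bounded m n ps = Linked _≥_ (m ∷ ps) × All (0 <_) ps × sum ps ≡ n

  sound : ∀ fuel m n {ps} → ps ∈ partitionsUpTo fuel m n → Bounded m n ps
  sound zero       m zero    (here refl) = [-] , [] , refl
  sound (suc fuel) m zero    (here refl) = [-] , [] , refl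
  sound (suc fuel) m (suc n) {ps} ps∈
    using f ← (λ a → map (suc a ∷_) (partitionsUpTo fuel (suc a) (n ∸ a)))
    with a , a∈ , ps∈fa ← find (∈-concatMap⁻ f {xs = upTo (m ⊓ suc n)} ps∈)
    with qs , qs∈ , refl ← ∈-map⁻ (suc a ∷_) ps∈fa
    with a< ← ∈-upTo⁻ a∈
    with l , pos , eq ← sound fuel (suc a) (n ∸ a) qs∈
    = m≤n⊓o⇒m≤n m (suc n) a< ∷ l , z<s ∷ pos
    , cong suc (trans (cong (a +_) eq) (m+[n∸m]≡n (s≤s⁻¹ (m≤n⊓o⇒m≤o m (suc n) a<))))

  complete : ∀ fuel m n {ps} → n ≤ fuel → Bounded m n ps → ps ∈ partitionsUpTo fuel m n
  complete zero       m zero    {[]}    _ _ = here refl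
  complete (suc fuel) m zero    {[]}    _ _ = here refl
  complete _          m _       {zero  ∷ ps} _ (_ , () ∷ _ , _)
  complete (suc fuel) m (suc n) {suc a ∷ ps} n≤ (a< ∷ l , _ ∷ pos , eq) =
    ∈-concatMap⁺ (λ a → map (suc a ∷_) (partitionsUpTo fuel (suc a) (n ∸ a)))
      (lose (∈-upTo⁺ (⊓-glb a< (s≤s a≤n)))
            (∈-map⁺ (suc a ∷_)
              (complete fuel (suc a) (n ∸ a) (≤-trans (m∸n≤m n a) (s≤s⁻¹ n≤))
                (l , pos , sym (trans (cong (_∸ a) (sym eq′)) (m+n∸m≡n a (sum ps)))))))
    where
    eq′ : a + sum ps ≡ n
    eq′ = suc-injective eq
    a≤n : a ≤ n
    a≤n = subst (a ≤_) eq′ (m≤m+n a (sum ps))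

  unique : ∀ fuel m n → Unique (partitionsUpTo fuel m n)
  unique zero       m zero    = [] ∷ []
  unique (suc fuel) m zero    = [] ∷ []
  unique zero       m (suc n) = []
  unique (suc fuel) m (suc n) = Uniqueₚ.concat⁺
    (Allₚ.map⁺ (All.tabulate λ {a} _ →
      Uniqueₚ.map⁺ ∷-injectiveʳ (unique fuel (suc a) (n ∸ a))))
    (AllPairsₚ.map⁺ (AllPairs.map disjoint (Uniqueₚ.upTo⁺ (m ⊓ suc n))))
    where
    disjoint : ∀ {x y} {xss yss : List (List ℕ)} → x ≢ y →
               Disjoint (map (suc x ∷_) xss) (map (suc y ∷_) yss)
    disjoint {x} {y} x≢y (∈x , ∈y)
      with _ , _ , refl ← ∈-map⁻ (suc x ∷_) ∈x
      with _ , _ , refl ← ∈-map⁻ (suc y ∷_) ∈y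
      = x≢y refl

∈-partitions : ∀ {n ps} → ps ∈ partitions n ⇔ IsPartition n ps
∈-partitions {n} = mk⇔ to from
  where
  to : ∀ {ps} → ps ∈ partitions n → IsPartition n ps
  to ps∈ = let l , pos , eq = sound n n n ps∈ in isPartition (Linked.tail l) pos eq

  bounded : ∀ {ps} → Linked _≥_ ps → sum ps ≡ n → Linked _≥_ (n ∷ ps)
  bounded {[]}     _ _    = [-]
  bounded {p ∷ ps} l refl = m≤m+n p (sum ps) ∷ l

  from : ∀ {ps} → IsPartition n ps → ps ∈ partitions n
  from (isPartition l pos eq) = complete n n n ≤-refl (bounded l eq , pos , eq)

partitions-unique : ∀ n → Unique (partitions n)
partitions-unique n = unique n n n

{-# OPTIONS --safe #-}

-- Modulo 2 the generating function of b₂, the product of 1 / (1 - q ^ k) over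
-- odd k, equals E = ∏ (1 - q ^ k): split E into its odd and even factors, and
-- use 1 - q ^ 2k ≡ (1 - q ^ k) ^ 2 to see that the even part is E ^ 2.  By
-- Euler's pentagonal number theorem, obtained here from Shanks' finite
-- identity, b₂ N is then odd only for N = m (3m ± 1) / 2, and in that case
-- 24 N + 1 = (6m ± 1) ^ 2.  For the N of the theorem, p divides 24 N + 1 exactly
-- 2α - 1 times, so that 24 N + 1 is not a square.
module Submission where

open import Defs
open import Data.Nat using (ℕ; _+_; _*_; _∸_; _^_; _/_; _≤_; _<_)
open import Data.Nat.Divisibility using (_∣_)
open import Data.Nat.Primality using (Prime)

open import Algebra.Properties.CommutativeSemigroup using (interchange)
open import Algebra.Properties.Group using (∙-cancelʳ)
open import Data.List.Base using (List; []; _∷_; _++_; map; concatMap; filter; length; upTo)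
open import Data.List.Properties
open import Data.List.Relation.Unary.All as All using ([]; _∷_)
import Data.List.Relation.Unary.All.Properties as Allₚ
open import Data.Nat using (zero; suc; _%_; _⊓_; _≤?_; _≟_; z≤n; s≤s; s≤s⁻¹; parity; >-nonZero)
open import Data.Nat.DivMod using (m*n/n≡m; m%n<n; m≡m%n+[m/n]*n; %-distribˡ-*)
open import Data.Nat.Divisibility hiding (_∣_)
open import Data.Nat.Primality using (euclidsLemma; prime⇒nonZero; prime⇒irreducible; ¬prime[1])
open import Data.Nat.Properties
open import Data.Nat.Tactic.RingSolver using (solve-∀)
open import Data.Parity.Base as ℙ using (Parity; 0ℙ; 1ℙ)
import Data.Parity.Properties as ℙₚ
open import Data.Product.Base using (∃; _,_; proj₁; proj₂)
open import Data.Sum.Base using (_⊎_; inj₁; inj₂; reduce)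
open import Function.Base using (_∘_)
open import Level using (0ℓ)
open import Relation.Binary.PropositionalEquality
open import Relation.Nullary using (yes; no; contradiction)
open import Relation.Nullary.Decidable using (toWitness; _⊎-dec_)
open import Relation.Unary using (Pred; Decidable)

-- Power series modulo 2: shifts and factors 1 + q ^ k.

-- Power series in q over the field with two elements.
Series : Set
Series = ℕ → Parity

one : Series
one zero    = 1ℙ
one (suc _) = 0ℙ

infixl 6 _⊕_
_⊕_ : Series → Series → Series
(f ⊕ g) n = f n ℙ.+ g n

-- Multiplication by q ^ k.
shift : ℕ → Series → Series
shift zero    f n       = f n
shift (suc k) f zero    = 0ℙ
shift (suc k) f (suc n) = shift k f n

-- Multiplication by 1 + q ^ k.
mul : ℕ → Series → Series
mul k f = f ⊕ shift k f

-- Multiplication by the product of 1 + q ^ k over s < k ≤ s + d.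
prod : (s d : ℕ) → Series → Series
prod s zero    f = f
prod s (suc d) f = mul (suc (s + d)) (prod s d f)

-- Multiplication by the product of 1 + q ^ k over the r smallest odd k.
oddProd : ℕ → Series → Series
oddProd zero    f = f
oddProd (suc r) f = oddProd r (mul (suc (r + r)) f)

private
  variable
    f g : Series

cancel-middle : ∀ x y z → (x ℙ.+ y) ℙ.+ (y ℙ.+ z) ≡ x ℙ.+ z
cancel-middle 0ℙ 0ℙ z  = refl
cancel-middle 0ℙ 1ℙ 0ℙ = refl
cancel-middle 0ℙ 1ℙ 1ℙ = refl
cancel-middle 1ℙ 0ℙ z  = refl
cancel-middle 1ℙ 1ℙ z  = refl

shift-local : ∀ k n → (∀ j → j ≤ n → f j ≡ g j) → shift k f n ≡ shift k g n
shift-local zero    n       eq = eq n ≤-refl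
shift-local (suc k) zero    eq = refl
shift-local (suc k) (suc n) eq = shift-local k n (λ j j≤n → eq j (m≤n⇒m≤1+n j≤n))

-- A positive shift reads only coefficients strictly below n, which is what the strong induction in
-- `mul-cancel` needs.
shift-suc-local : ∀ k n → (∀ j → j < n → f j ≡ g j) → shift (suc k) f n ≡ shift (suc k) g n
shift-suc-local k zero    eq = refl
shift-suc-local k (suc n) eq = shift-local k n (λ j j≤n → eq j (s≤s j≤n))

shift-cong : ∀ k → f ≗ g → shift k f ≗ shift k g
shift-cong k eq n = shift-local k n (λ j _ → eq j)

shift-⊕ : ∀ k f g → shift k (f ⊕ g) ≗ shift k f ⊕ shift k g
shift-⊕ zero    f g n       = refl
shift-⊕ (suc k) f g zero    = refl
shift-⊕ (suc k) f g (suc n) = shift-⊕ k f g n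

shift-shift : ∀ j k f → shift j (shift k f) ≗ shift (j + k) f
shift-shift zero    k f n       = refl
shift-shift (suc j) k f zero    = refl
shift-shift (suc j) k f (suc n) = shift-shift j k f n

shift-comm : ∀ j k f → shift j (shift k f) ≗ shift k (shift j f)
shift-comm j k f n = begin
  shift j (shift k f) n ≡⟨ shift-shift j k f n ⟩
  shift (j + k) f n     ≡⟨ cong (λ e → shift e f n) (+-comm j k) ⟩
  shift (k + j) f n     ≡⟨ shift-shift k j f n ⟨
  shift k (shift j f) n ∎
  where open ≡-Reasoning

shift-below : ∀ k f {n} → n < k → shift k f n ≡ 0ℙ
shift-below (suc k) f {zero}  _   = refl
shift-below (suc k) f {suc n} n<k = shift-below k f (s≤s⁻¹ n<k)

shift-above : ∀ k f m → shift k f (k + m) ≡ f m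
shift-above zero    f m = refl
shift-above (suc k) f m = shift-above k f m

shift-one : ∀ {k n} → n ≢ k → shift k one n ≡ 0ℙ
shift-one {zero}  {zero}  n≢k with () ← n≢k refl
shift-one {zero}  {suc n} n≢k = refl
shift-one {suc k} {zero}  n≢k = refl
shift-one {suc k} {suc n} n≢k = shift-one (λ eq → n≢k (cong suc eq))

shift-mul : ∀ e k f n → shift e (mul k f) n ≡ shift e f n ℙ.+ shift (e + k) f n
shift-mul e k f n = trans (shift-⊕ e f (shift k f) n) (cong (shift e f n ℙ.+_) (shift-shift e k f n))

mul-cong : ∀ k → f ≗ g → mul k f ≗ mul k g
mul-cong k eq n = cong₂ ℙ._+_ (eq n) (shift-cong k eq n)

mul-comm : ∀ j k f → mul j (mul k f) ≗ mul k (mul j f)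
mul-comm j k f n = begin
  (f n ℙ.+ shift k f n) ℙ.+ shift j (mul k f) n
    ≡⟨ cong (mul k f n ℙ.+_) (shift-⊕ j f (shift k f) n) ⟩
  (f n ℙ.+ shift k f n) ℙ.+ (shift j f n ℙ.+ shift j (shift k f) n)
    ≡⟨ interchange ℙₚ.+-commutativeSemigroup (f n) _ _ _ ⟩
  (f n ℙ.+ shift j f n) ℙ.+ (shift k f n ℙ.+ shift j (shift k f) n)
    ≡⟨ cong (λ t → mul j f n ℙ.+ (shift k f n ℙ.+ t)) (shift-comm j k f n) ⟩
  (f n ℙ.+ shift j f n) ℙ.+ (shift k f n ℙ.+ shift k (shift j f) n)
    ≡⟨ cong (mul j f n ℙ.+_) (shift-⊕ k f (shift j f) n) ⟨
  (f n ℙ.+ shift j f n) ℙ.+ shift k (mul j f) n ∎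
  where open ≡-Reasoning

-- The two cross terms are equal, so they cancel in characteristic 2.
mul-square : ∀ k f → mul k (mul k f) ≗ mul (k + k) f
mul-square k f n = begin
  (f n ℙ.+ shift k f n) ℙ.+ shift k (mul k f) n
    ≡⟨ cong (mul k f n ℙ.+_) (shift-mul k k f n) ⟩
  (f n ℙ.+ shift k f n) ℙ.+ (shift k f n ℙ.+ shift (k + k) f n)
    ≡⟨ cancel-middle (f n) _ _ ⟩
  f n ℙ.+ shift (k + k) f n ∎
  where open ≡-Reasoning

mul-below : ∀ k f {n} → n < k → mul k f n ≡ f n
mul-below k f {n} n<k =
  trans (cong (f n ℙ.+_) (shift-below k f n<k)) (ℙₚ.+-identityʳ (f n))

-- The factor has constant term 1, so each coefficient is determined by the product and the earlier
-- coefficients. The bound N stays because `prod-below` controls only finitely many coefficients.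
mul-cancel : ∀ k N → (∀ n → n ≤ N → mul (suc k) f n ≡ mul (suc k) g n) →
             ∀ n → n ≤ N → f n ≡ g n
mul-cancel {f} {g} k N eq n n≤N = go (suc n) (s≤s n≤N) n ≤-refl
  where
  go : ∀ m → m ≤ suc N → ∀ n → n < m → f n ≡ g n
  go (suc m) m≤N n n<m = ∙-cancelʳ ℙₚ.+-0-group (shift (suc k) f n) (f n) (g n) (trans
    (eq n (≤-trans (s≤s⁻¹ n<m) (s≤s⁻¹ m≤N)))
    (cong (g n ℙ.+_) (sym (shift-suc-local k n λ j j<n →
      go m (<⇒≤ m≤N) j (≤-trans j<n (s≤s⁻¹ n<m))))))

-- Finite products of factors 1 + q ^ k.

prod-cong : ∀ s d → f ≗ g → prod s d f ≗ prod s d g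
prod-cong s zero    eq = eq
prod-cong s (suc d) eq = mul-cong (suc (s + d)) (prod-cong s d eq)

prod-mul : ∀ s d k f → prod s d (mul k f) ≗ mul k (prod s d f)
prod-mul s zero    k f n = refl
prod-mul s (suc d) k f n = trans
  (mul-cong (suc (s + d)) (prod-mul s d k f) n)
  (mul-comm (suc (s + d)) k (prod s d f) n)

-- `prod` grows at its top factor, but the telescoping in `correction-step` must split off the
-- lowest one; the factors commute.
prod-first : ∀ s d f → prod s (suc d) f ≗ mul (suc s) (prod (suc s) d f)
prod-first s zero    f n = cong (λ k → mul (suc k) f n) (+-identityʳ s)
prod-first s (suc d) f n = begin
  mul (suc (s + suc d)) (prod s (suc d) f) n
    ≡⟨ mul-cong (suc (s + suc d)) (prod-first s d f) n ⟩
  mul (suc (s + suc d)) (mul (suc s) (prod (suc s) d f)) n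
    ≡⟨ mul-comm (suc (s + suc d)) (suc s) (prod (suc s) d f) n ⟩
  mul (suc s) (mul (suc (s + suc d)) (prod (suc s) d f)) n
    ≡⟨ cong (λ k → mul (suc s) (mul (suc k) (prod (suc s) d f)) n) (+-suc s d) ⟩
  mul (suc s) (prod (suc s) (suc d) f) n ∎
  where open ≡-Reasoning

-- Factors with exponent above r do not touch coefficients up to r, so a long enough finite product
-- can stand for E.
prod-below : ∀ d r f {n} → n ≤ r → prod 0 (d + r) f n ≡ prod 0 r f n
prod-below zero    r f n≤r = refl
prod-below (suc d) r f n≤r = trans
  (mul-below (suc (d + r)) (prod 0 (d + r) f) (s≤s (≤-trans n≤r (m≤n+m r d))))
  (prod-below d r f n≤r)

prod-cancel : ∀ s d N → (∀ n → n ≤ N → prod s d f n ≡ prod s d g n) →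
              ∀ n → n ≤ N → f n ≡ g n
prod-cancel s zero    N eq = eq
prod-cancel s (suc d) N eq = prod-cancel s d N (mul-cancel (s + d) N eq)

oddProd-cong : ∀ r → f ≗ g → oddProd r f ≗ oddProd r g
oddProd-cong zero    eq = eq
oddProd-cong (suc r) eq = oddProd-cong r (mul-cong (suc (r + r)) eq)

-- Each step adds the factors for 2r + 1 and 2r + 2. The even one becomes two copies of 1 + q ^ (r +
-- 1), one for each `prod 0 r`; the odd one is absorbed into the series as `f′`.
prod-double : ∀ r f → prod 0 (r + r) f ≗ prod 0 r (prod 0 r (oddProd r f))
prod-double zero    f n = refl
prod-double (suc r) f n = begin
  mul (suc (r + suc r)) (prod 0 (r + suc r) f) n
    ≡⟨ cong (λ k → mul (suc (r + suc r)) (prod 0 k f) n) (+-suc r r) ⟩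
  mul (suc r + suc r) (mul (suc (r + r)) P) n
    ≡⟨ mul-square (suc r) (mul (suc (r + r)) P) n ⟨
  M (M (mul (suc (r + r)) P)) n
    ≡⟨ M-cong (M-cong (prod-mul 0 (r + r) (suc (r + r)) f)) n ⟨
  M (M (prod 0 (r + r) f′)) n
    ≡⟨ M-cong (M-cong (prod-double r f′)) n ⟩
  M (M (prod 0 r (prod 0 r (oddProd r f′)))) n
    ≡⟨ M-cong (prod-mul 0 r (suc r) (prod 0 r (oddProd r f′))) n ⟨
  M (prod 0 r (M (prod 0 r (oddProd r f′)))) n ∎
  where
  open ≡-Reasoning
  P f′ : Series
  P  = prod 0 (r + r) f
  f′ = mul (suc (r + r)) f
  M : Series → Series
  M = mul (suc r)
  M-cong : ∀ {g h} → g ≗ h → M g ≗ M h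
  M-cong = mul-cong (suc r)

-- Up to degree N the factors beyond N are invisible, so `prod-double` reads E f = E ^ 2
-- (`oddProd N f`); cancelling one E leaves f = E.
oddProd-inverse : ∀ N → oddProd N f ≗ one → f N ≡ prod 0 N one N
oddProd-inverse {f} N eq = trans
  (sym (prod-cancel 0 N N (λ n n≤N →
    trans (sym (prod-double N f n)) (prod-below N N f n≤N)) N ≤-refl))
  (prod-cong 0 N eq N)

-- Shanks' finite identity.

triangle : ℕ → ℕ
triangle zero    = zero
triangle (suc s) = suc s + triangle s

-- Shanks' identity for N = s + d concerns the sum over 0 ≤ t ≤ N of
-- q ^ (t N + t (t + 1) / 2) (1 + q ^ (t + 1)) ⋯ (1 + q ^ N); row s d keeps t ≤ s.
term : (s d : ℕ) → Series
term s d = shift (s * (s + d) + triangle s) (prod s d one)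

row : (s d : ℕ) → Series
row zero    d = term zero d
row (suc s) d = row s (suc d) ⊕ term (suc s) d

-- Raising N by one changes the truncated sum by a single summand, as the
-- differences telescope.
correction : (s d : ℕ) → Series
correction s d = shift (suc s * suc (s + d) + triangle s) (prod s d one)

-- Both products on the left contain `R`: one has an extra lowest factor, the other an extra top
-- factor. Expanding these gives four shifts of `R`, of which the middle two coincide and cancel.
correction-step : ∀ s d n → correction s (suc d) n ℙ.+ term (suc s) (suc d) n ≡
                            term (suc s) d n ℙ.+ correction (suc s) d n
correction-step s d n = begin
  shift e₁ (prod s (suc d) one) n ℙ.+ shift e₂ (mul k R) n
    ≡⟨ cong₂ ℙ._+_ (trans (shift-cong e₁ (prod-first s d one) n) (shift-mul e₁ (suc s) R n))
                   (shift-mul e₂ k R n) ⟩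
  (shift e₁ R n ℙ.+ shift (e₁ + suc s) R n) ℙ.+ (shift e₂ R n ℙ.+ shift (e₂ + k) R n)
    ≡⟨ cong (λ e → (shift e₁ R n ℙ.+ shift e R n) ℙ.+ (shift e₂ R n ℙ.+ shift (e₂ + k) R n))
            (e₁+s≡e₂ s d (triangle s)) ⟩
  (shift e₁ R n ℙ.+ shift e₂ R n) ℙ.+ (shift e₂ R n ℙ.+ shift (e₂ + k) R n)
    ≡⟨ cancel-middle (shift e₁ R n) _ _ ⟩
  shift e₁ R n ℙ.+ shift (e₂ + k) R n
    ≡⟨ cong₂ (λ e e′ → shift e R n ℙ.+ shift e′ R n)
             (e₁≡ s d (triangle s)) (e₂+k≡ s d (triangle s)) ⟩
  term (suc s) d n ℙ.+ correction (suc s) d n ∎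
  where
  open ≡-Reasoning
  k e₁ e₂ : ℕ
  k  = suc (suc s + d)
  e₁ = suc s * suc (s + suc d) + triangle s
  e₂ = suc s * (suc s + suc d) + triangle (suc s)
  R : Series
  R  = prod (suc s) d one
  e₁+s≡e₂ : ∀ s d t → suc s * suc (s + suc d) + t + suc s ≡
                      suc s * (suc s + suc d) + (suc s + t)
  e₁+s≡e₂ = solve-∀
  e₁≡ : ∀ s d t → suc s * suc (s + suc d) + t ≡ suc s * (suc s + d) + (suc s + t)
  e₁≡ = solve-∀
  e₂+k≡ : ∀ s d t → suc s * (suc s + suc d) + (suc s + t) + suc (suc s + d) ≡
                    suc (suc s) * suc (suc s + d) + (suc s + t)
  e₂+k≡ = solve-∀

-- For s = 0 the change is the q ^ (d + 1) part of the new factor; each later summand passes it on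
-- by `correction-step`.
row-suc : ∀ s d n → row s (suc d) n ≡ row s d n ℙ.+ correction s d n
row-suc zero d n =
  cong (λ e → prod 0 d one n ℙ.+ shift e (prod 0 d one) n)
       (sym (trans (+-identityʳ (suc d + 0)) (+-identityʳ (suc d))))
row-suc (suc s) d n = begin
  row s (suc (suc d)) n ℙ.+ term (suc s) (suc d) n
    ≡⟨ cong (ℙ._+ term (suc s) (suc d) n) (row-suc s (suc d) n) ⟩
  (row s (suc d) n ℙ.+ correction s (suc d) n) ℙ.+ term (suc s) (suc d) n
    ≡⟨ ℙₚ.+-assoc (row s (suc d) n) _ _ ⟩
  row s (suc d) n ℙ.+ (correction s (suc d) n ℙ.+ term (suc s) (suc d) n)
    ≡⟨ cong (row s (suc d) n ℙ.+_) (correction-step s d n) ⟩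
  row s (suc d) n ℙ.+ (term (suc s) d n ℙ.+ correction (suc s) d n)
    ≡⟨ ℙₚ.+-assoc (row s (suc d) n) _ _ ⟨
  row (suc s) d n ℙ.+ correction (suc s) d n ∎
  where open ≡-Reasoning

-- Every summand with t > 0 starts beyond degree N = s + d, so only the full product at t = 0 is
-- seen.
row-below : ∀ s d {n} → n ≤ s + d → row s d n ≡ prod 0 (s + d) one n
row-below zero    d n≤ = refl
row-below (suc s) d {n} n≤ = begin
  row s (suc d) n ℙ.+ term (suc s) d n
    ≡⟨ cong₂ ℙ._+_ (row-below s (suc d) (subst (n ≤_) (sym (+-suc s d)) n≤))
                   (shift-below _ (prod (suc s) d one)
                     (≤-<-trans n≤ (≤-<-trans (m≤m+n _ _) (m<m+n _ (s≤s z≤n))))) ⟩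
  prod 0 (s + suc d) one n ℙ.+ 0ℙ
    ≡⟨ ℙₚ.+-identityʳ _ ⟩
  prod 0 (s + suc d) one n
    ≡⟨ cong (λ e → prod 0 e one n) (+-suc s d) ⟩
  prod 0 (suc s + d) one n ∎
  where open ≡-Reasoning

-- Pentagonal exponents and the vanishing of coefficients.

2*triangle : ∀ s → 2 * triangle s ≡ s * suc s
2*triangle zero    = refl
2*triangle (suc s) = begin
  2 * (suc s + triangle s)     ≡⟨ *-distribˡ-+ 2 (suc s) (triangle s) ⟩
  2 * suc s + 2 * triangle s   ≡⟨ cong (2 * suc s +_) (2*triangle s) ⟩
  2 * suc s + s * suc s        ≡⟨ *-distribʳ-+ (suc s) 2 s ⟨
  suc (suc s) * suc s          ≡⟨ *-comm (suc (suc s)) (suc s) ⟩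
  suc s * suc (suc s)          ∎
  where open ≡-Reasoning

-- j (3j ∓ 1) / 2 for j = m + 1, in the form in which the exponents arise.
pentagonal⁻ pentagonal⁺ : ℕ → ℕ
pentagonal⁻ m = suc m * suc (m + 0) + triangle m
pentagonal⁺ m = suc m * (suc m + 0) + triangle (suc m)

-- With j = m + 1 this is 36 j ^ 2 - 12 j + 1 = (6j - 1) ^ 2. The ring solver sees `triangle m` as a
-- variable, so 24 is split as 12 * 2 to bring in `2*triangle`.
pentagonal⁻-square : ∀ m → 24 * pentagonal⁻ m + 1 ≡ (6 * m + 5) * (6 * m + 5)
pentagonal⁻-square m = begin
  24 * (suc m * suc (m + 0) + triangle m) + 1      ≡⟨ expand m (triangle m) ⟩
  24 * (suc m * suc m) + 12 * (2 * triangle m) + 1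
    ≡⟨ cong (λ t → 24 * (suc m * suc m) + 12 * t + 1) (2*triangle m) ⟩
  24 * (suc m * suc m) + 12 * (m * suc m) + 1      ≡⟨ square m ⟩
  (6 * m + 5) * (6 * m + 5)                        ∎
  where
  open ≡-Reasoning
  expand : ∀ m t → 24 * (suc m * suc (m + 0) + t) + 1 ≡ 24 * (suc m * suc m) + 12 * (2 * t) + 1
  expand = solve-∀
  square : ∀ m → 24 * (suc m * suc m) + 12 * (m * suc m) + 1 ≡ (6 * m + 5) * (6 * m + 5)
  square = solve-∀

pentagonal⁺-square : ∀ m → 24 * pentagonal⁺ m + 1 ≡ (6 * m + 7) * (6 * m + 7)
pentagonal⁺-square m = begin
  24 * (suc m * suc (m + 0) + (suc m + triangle m)) + 1   ≡⟨ expand m (triangle m) ⟩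
  (24 * (suc m * suc (m + 0) + triangle m) + 1) + 24 * suc m
    ≡⟨ cong (_+ 24 * suc m) (pentagonal⁻-square m) ⟩
  (6 * m + 5) * (6 * m + 5) + 24 * suc m                  ≡⟨ square m ⟩
  (6 * m + 7) * (6 * m + 7)                               ∎
  where
  open ≡-Reasoning
  expand : ∀ m t → 24 * (suc m * suc (m + 0) + (suc m + t)) + 1 ≡
                   (24 * (suc m * suc (m + 0) + t) + 1) + 24 * suc m
  expand = solve-∀
  square : ∀ m → (6 * m + 5) * (6 * m + 5) + 24 * suc m ≡ (6 * m + 7) * (6 * m + 7)
  square = solve-∀

module _ n (¬square : ∀ x → 24 * n + 1 ≢ x * x) where

  shift-one-vanishes : ∀ e x → 24 * e + 1 ≡ x * x → shift e one n ≡ 0ℙ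
  shift-one-vanishes e x eq = shift-one {e} λ { refl → ¬square x eq }

  -- At d = 0 the products are empty, so passing from N = m to N = m + 1 adds just two monomials, q
  -- to the powers `pentagonal⁻ m` and `pentagonal⁺ m`.
  row-vanishes : ∀ m → row m 0 n ≡ 0ℙ
  -- The first row is the constant 1, whose exponent 0 gives the square 1.
  row-vanishes zero    = shift-one-vanishes 0 1 refl
  row-vanishes (suc m) = begin
    row m 1 n ℙ.+ term (suc m) 0 n
      ≡⟨ cong₂ ℙ._+_ (row-suc m 0 n)
                     (shift-one-vanishes (pentagonal⁺ m) (6 * m + 7) (pentagonal⁺-square m)) ⟩
    (row m 0 n ℙ.+ correction m 0 n) ℙ.+ 0ℙ
      ≡⟨ cong₂ (λ x y → (x ℙ.+ y) ℙ.+ 0ℙ) (row-vanishes m)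
               (shift-one-vanishes (pentagonal⁻ m) (6 * m + 5) (pentagonal⁻-square m)) ⟩
    0ℙ ∎
    where open ≡-Reasoning

  prod-vanishes : prod 0 n one n ≡ 0ℙ
  prod-vanishes = begin
    prod 0 n one n       ≡⟨ cong (λ e → prod 0 e one n) (+-identityʳ n) ⟨
    prod 0 (n + 0) one n ≡⟨ row-below n 0 (m≤m+n n 0) ⟨
    row n 0 n            ≡⟨ row-vanishes n ⟩
    0ℙ                   ∎
    where open ≡-Reasoning

-- The generating function of partitions into odd parts.

-- Recursive calls keep more fuel than their size requires; this restores the form with fuel equal
-- to size used by `oddParts≤`.
partitionsUpTo-fuel : ∀ {k l} m {n} → n ≤ k → n ≤ l → partitionsUpTo k m n ≡ partitionsUpTo l m n
partitionsUpTo-fuel {zero}  {zero}  m z≤n z≤n = refl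
partitionsUpTo-fuel {zero}  {suc l} m z≤n z≤n = refl
partitionsUpTo-fuel {suc k} {zero}  m z≤n z≤n = refl
partitionsUpTo-fuel {suc k} {suc l} m {zero}  _ _ = refl
partitionsUpTo-fuel {suc k} {suc l} m {suc n} (s≤s n≤k) (s≤s n≤l) =
  concatMap-cong (λ a → cong (map (suc a ∷_)) (partitionsUpTo-fuel (suc a)
    (≤-trans (m∸n≤m n a) n≤k) (≤-trans (m∸n≤m n a) n≤l))) (upTo (m ⊓ suc n))

partitionsUpTo-large : ∀ k {m n} → n ≤ m → partitionsUpTo k m n ≡ partitionsUpTo k n n
partitionsUpTo-large _       {n = zero}  _   = refl
partitionsUpTo-large zero    {n = suc n} _   = refl
partitionsUpTo-large (suc k) {n = suc n} n≤m =
  cong (concatMap _ ∘ upTo) (trans (m≥n⇒m⊓n≡n n≤m) (sym (⊓-idem (suc n))))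

-- The enumeration goes by increasing largest part, so the partitions with largest part m + 1 form
-- its last block.
partitionsUpTo-suc : ∀ m r → partitionsUpTo (suc m + r) (suc m) (suc m + r) ≡
  partitionsUpTo (suc m + r) m (suc m + r) ++ map (suc m ∷_) (partitionsUpTo r (suc m) r)
partitionsUpTo-suc m r = begin
  concatMap block (upTo (suc m ⊓ suc (m + r)))
    ≡⟨ cong (concatMap block ∘ upTo) (m≤n⇒m⊓n≡m (s≤s (m≤m+n m r))) ⟩
  concatMap block (upTo (suc m))
    ≡⟨ cong (concatMap block) (upTo-∷ʳ m) ⟨
  concatMap block (upTo m ++ (m ∷ []))
    ≡⟨ concatMap-++ block (upTo m) (m ∷ []) ⟩
  concatMap block (upTo m) ++ concatMap block (m ∷ [])
    ≡⟨ cong₂ _++_ (cong (concatMap block ∘ upTo) (sym (m≤n⇒m⊓n≡m (m≤n⇒m≤1+n (m≤m+n m r)))))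
                  (trans (++-identityʳ (block m)) (cong (map (suc m ∷_)) last)) ⟩
  partitionsUpTo (suc m + r) m (suc m + r) ++ map (suc m ∷_) (partitionsUpTo r (suc m) r) ∎
  where
  open ≡-Reasoning
  block : ℕ → List (List ℕ)
  block a = map (suc a ∷_) (partitionsUpTo (m + r) (suc a) (m + r ∸ a))
  last : partitionsUpTo (m + r) (suc m) (m + r ∸ m) ≡ partitionsUpTo r (suc m) r
  last rewrite m+n∸m≡n m r = partitionsUpTo-fuel (suc m) (m≤n+m r m) ≤-refl

countOdd : List (List ℕ) → Parity
countOdd pss = parity (length (filter (isRegular? 2) pss))

countOdd-++ : ∀ pss qss → countOdd (pss ++ qss) ≡ countOdd pss ℙ.+ countOdd qss
countOdd-++ pss qss = begin
  countOdd (pss ++ qss)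
    ≡⟨ cong (parity ∘ length) (filter-++ (isRegular? 2) pss qss) ⟩
  parity (length (filter (isRegular? 2) pss ++ filter (isRegular? 2) qss))
    ≡⟨ cong parity (length-++ (filter (isRegular? 2) pss)) ⟩
  parity (length (filter (isRegular? 2) pss) + length (filter (isRegular? 2) qss))
    ≡⟨ ℙₚ.+-homo-+ (length (filter (isRegular? 2) pss)) _ ⟩
  countOdd pss ℙ.+ countOdd qss ∎
  where open ≡-Reasoning

countOdd-even∷ : ∀ {a} → 2 ∣ a → ∀ pss → countOdd (map (a ∷_) pss) ≡ 0ℙ
countOdd-even∷ 2∣a pss = cong (parity ∘ length) (filter-none (isRegular? 2)
  (Allₚ.map⁺ (All.tabulate {xs = pss} λ _ → λ { (2∤a ∷ _) → 2∤a 2∣a })))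

module _ {A B : Set} {P : Pred A 0ℓ} {Q : Pred B 0ℓ} (P? : Decidable P) (Q? : Decidable Q) where

  length-filter-map : ∀ {f : B → A} → (∀ {x} → Q x → P (f x)) → (∀ {x} → P (f x) → Q x) →
                      ∀ xs → length (filter P? (map f xs)) ≡ length (filter Q? xs)
  length-filter-map         to from []       = refl
  length-filter-map {f = f} to from (x ∷ xs) with Q? x
  ... | yes q = trans (cong length (filter-accept P? (to q))) (cong suc (length-filter-map to from xs))
  ... | no ¬q = trans (cong length (filter-reject P? (¬q ∘ from))) (length-filter-map to from xs)

countOdd-odd∷ : ∀ {a} → 2 ∤ a → ∀ pss → countOdd (map (a ∷_) pss) ≡ countOdd pss
countOdd-odd∷ 2∤a =
  cong parity ∘ length-filter-map (isRegular? 2) (isRegular? 2) (2∤a ∷_) All.tail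

-- Modulo 2, the expansion of the product of 1 / (1 - q ^ k) over odd k ≤ m.
oddParts≤ : ℕ → Series
oddParts≤ m n = countOdd (partitionsUpTo n m n)

oddParts≤0 : oddParts≤ 0 ≗ one
oddParts≤0 zero    = refl
oddParts≤0 (suc n) = refl

oddParts≤-below : ∀ m {n} → n ≤ m → oddParts≤ (suc m) n ≡ oddParts≤ m n
oddParts≤-below m {n} n≤m = cong countOdd
  (trans (partitionsUpTo-large n (m≤n⇒m≤1+n n≤m)) (sym (partitionsUpTo-large n n≤m)))

oddParts≤-above : ∀ m r → oddParts≤ (suc m) (suc m + r) ≡
  oddParts≤ m (suc m + r) ℙ.+ countOdd (map (suc m ∷_) (partitionsUpTo r (suc m) r))
oddParts≤-above m r = trans (cong countOdd (partitionsUpTo-suc m r))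
  (countOdd-++ (partitionsUpTo (suc m + r) m (suc m + r)) _)

data Position (m : ℕ) : ℕ → Set where
  below : ∀ {n} → n ≤ m → Position m n
  above : ∀ r → Position m (suc m + r)

position : ∀ m n → Position m n
position m n with n ≤? m
... | yes n≤m = below n≤m
... | no  n≰m = subst (Position m) (m+[n∸m]≡n (≰⇒> n≰m)) (above (n ∸ suc m))

oddParts≤-even : ∀ {m} → 2 ∣ suc m → oddParts≤ (suc m) ≗ oddParts≤ m
oddParts≤-even {m} 2∣m n with position m n
... | below n≤m = oddParts≤-below m n≤m
... | above r   = trans (oddParts≤-above m r) (trans
  (cong (oddParts≤ m (suc m + r) ℙ.+_) (countOdd-even∷ 2∣m (partitionsUpTo r (suc m) r)))
  (ℙₚ.+-identityʳ _))

-- Removing one part m + 1 matches the last block with the partitions of r, counted by `t`. The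
-- shifted series contributes `t` again, and the two cancel.
oddParts≤-odd : ∀ {m} → 2 ∤ suc m → mul (suc m) (oddParts≤ (suc m)) ≗ oddParts≤ m
oddParts≤-odd {m} 2∤m n with position m n
... | below n≤m = trans (mul-below (suc m) (oddParts≤ (suc m)) (s≤s n≤m)) (oddParts≤-below m n≤m)
... | above r   = begin
  oddParts≤ (suc m) (suc m + r) ℙ.+ shift (suc m) (oddParts≤ (suc m)) (suc m + r)
    ≡⟨ cong₂ ℙ._+_ (oddParts≤-above m r) (shift-above (suc m) (oddParts≤ (suc m)) r) ⟩
  oddParts≤ m (suc m + r) ℙ.+ countOdd (map (suc m ∷_) (partitionsUpTo r (suc m) r)) ℙ.+ t
    ≡⟨ cong (λ u → oddParts≤ m (suc m + r) ℙ.+ u ℙ.+ t) (countOdd-odd∷ 2∤m (partitionsUpTo r (suc m) r)) ⟩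
  oddParts≤ m (suc m + r) ℙ.+ t ℙ.+ t
    ≡⟨ ℙₚ.+-assoc (oddParts≤ m (suc m + r)) t t ⟩
  oddParts≤ m (suc m + r) ℙ.+ (t ℙ.+ t)
    ≡⟨ cong (oddParts≤ m (suc m + r) ℙ.+_) (ℙₚ.p+p≡0ℙ t) ⟩
  oddParts≤ m (suc m + r) ℙ.+ 0ℙ
    ≡⟨ ℙₚ.+-identityʳ _ ⟩
  oddParts≤ m (suc m + r) ∎
  where
  open ≡-Reasoning
  t : Parity
  t = oddParts≤ (suc m) r

oddProd-oddParts : ∀ r → oddProd r (oddParts≤ (r + r)) ≗ one
oddProd-oddParts zero    n = oddParts≤0 n
oddProd-oddParts (suc r) n = begin
  oddProd r (mul (suc (r + r)) (oddParts≤ (suc (r + suc r)))) n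
    ≡⟨ cong (λ e → oddProd r (mul (suc (r + r)) (oddParts≤ (suc e))) n) (+-suc r r) ⟩
  oddProd r (mul (suc (r + r)) (oddParts≤ (suc (suc (r + r))))) n
    ≡⟨ oddProd-cong r (mul-cong (suc (r + r)) (oddParts≤-even 2∣2+2r)) n ⟩
  oddProd r (mul (suc (r + r)) (oddParts≤ (suc (r + r)))) n
    ≡⟨ oddProd-cong r (oddParts≤-odd 2∤1+2r) n ⟩
  oddProd r (oddParts≤ (r + r)) n
    ≡⟨ oddProd-oddParts r n ⟩
  one n ∎
  where
  open ≡-Reasoning
  2∣2r : 2 ∣ r + r
  2∣2r = subst (2 ∣_) (cong (r +_) (+-identityʳ r)) (m∣m*n r)
  2∣2+2r : 2 ∣ suc (suc (r + r))
  2∣2+2r = ∣m∣n⇒∣m+n (∣-refl {2}) 2∣2r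
  2∤1+2r : 2 ∤ suc (r + r)
  2∤1+2r 2∣ with ∣1⇒≡1 (∣m+n∣m⇒∣n (subst (2 ∣_) (+-comm 1 (r + r)) 2∣) 2∣2r)
  ... | ()

parity-b₂ : ∀ n → parity (b 2 n) ≡ prod 0 n one n
parity-b₂ n = trans
  -- Parts above n cannot occur, so the bound is raised to n + n to fit `oddProd-oddParts`.
  (sym (cong countOdd (partitionsUpTo-large n (m≤m+n n n))))
  (oddProd-inverse n (oddProd-oddParts n))

parity≡0⇒2∣ : ∀ n → parity n ≡ 0ℙ → 2 ∣ n
parity≡0⇒2∣ zero          _  = 2 ∣0
parity≡0⇒2∣ (suc (suc n)) eq = ∣m∣n⇒∣m+n ∣-refl (parity≡0⇒2∣ n eq)

2∣b₂ : ∀ n → (∀ x → 24 * n + 1 ≢ x * x) → 2 ∣ b 2 n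
2∣b₂ n ¬square = parity≡0⇒2∣ (b 2 n) (trans (parity-b₂ n) (prod-vanishes n ¬square))

-- Arithmetic modulo 24 and powers of p.

-- Every unit modulo 24 squares to 1; the 24 cases are decided by evaluation.
residues : ∀ {r} → r < 24 → 2 ∣ r ⊎ 3 ∣ r ⊎ (r * r) % 24 ≡ 1
residues = toWitness {a? = allUpTo? (λ r → (2 ∣? r) ⊎-dec ((3 ∣? r) ⊎-dec ((r * r) % 24 ≟ 1))) 24} _

module _ {p} (pp : Prime p) (5≤p : 5 ≤ p) where

  private instance _ = prime⇒nonZero pp

  ∤-prime : ∀ {d} → 1 < d → d < 5 → d ∤ p
  ∤-prime 1<d d<5 d∣p with prime⇒irreducible pp d∣p
  ... | inj₁ refl = contradiction 1<d (<-irrefl refl)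
  ... | inj₂ refl = <⇒≱ d<5 5≤p

  ∤-residue : ∀ {d} → 1 < d → d < 5 → d ∣ 24 → d ∤ p % 24
  ∤-residue 1<d d<5 d∣24 d∣r = ∤-prime 1<d d<5
    (subst (_ ∣_) (sym (m≡m%n+[m/n]*n p 24)) (∣m∣n⇒∣m+n d∣r (∣n⇒∣m*n (p / 24) d∣24)))

  square≡1[24] : ∃ λ k → p * p ≡ 1 + 24 * k
  square≡1[24] with residues (m%n<n p 24)
  ... | inj₁ 2∣r        = contradiction 2∣r (∤-residue (s≤s (s≤s z≤n)) (s≤s (s≤s (s≤s z≤n))) (divides 12 refl))
  ... | inj₂ (inj₁ 3∣r) = contradiction 3∣r (∤-residue (s≤s (s≤s z≤n)) (s≤s (s≤s (s≤s (s≤s z≤n)))) (divides 8 refl))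
  ... | inj₂ (inj₂ eq)  = p * p / 24 , (begin
    p * p                             ≡⟨ m≡m%n+[m/n]*n (p * p) 24 ⟩
    p * p % 24 + p * p / 24 * 24      ≡⟨ cong₂ _+_ (trans (%-distribˡ-* p p 24) eq) (*-comm (p * p / 24) 24) ⟩
    1 + 24 * (p * p / 24)             ∎)
    where open ≡-Reasoning

  -- This makes the division by 24 in the theorem exact.
  even-power≡1[24] : ∀ a → ∃ λ k → p ^ (2 * a) ≡ 1 + 24 * k
  even-power≡1[24] zero    = 0 , refl
  even-power≡1[24] (suc a) with k , eq ← square≡1[24] | l , eq′ ← even-power≡1[24] a =
    l + k + 24 * (k * l) , (begin
    p ^ (2 * suc a)             ≡⟨ cong (p ^_) (*-suc 2 a) ⟩
    p * (p * p ^ (2 * a))       ≡⟨ *-assoc p p _ ⟨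
    p * p * p ^ (2 * a)         ≡⟨ cong₂ _*_ eq eq′ ⟩
    (1 + 24 * k) * (1 + 24 * l) ≡⟨ expand k l ⟩
    1 + 24 * (l + k + 24 * (k * l)) ∎)
    where
    open ≡-Reasoning
    expand : ∀ k l → (1 + 24 * k) * (1 + 24 * l) ≡ 1 + 24 * (l + k + 24 * (k * l))
    expand = solve-∀

  -- Otherwise p would divide both p * p = 1 + 24 k and 24 k, hence 1.
  ∤24 : p ∤ 24
  ∤24 p∣24 with k , eq ← square≡1[24] = ¬prime[1] (subst Prime
    (∣1⇒≡1 (∣m+n∣m⇒∣n (subst (p ∣_) (trans eq (+-comm 1 (24 * k))) (m∣m*n p)) (∣m⇒∣m*n k p∣24))) pp)

-- Descent: p divides x, so x = y p and one p cancels. If a = 0, then p divides m; otherwise a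
-- second p cancels, leaving the same equation for a - 1 and y.
odd-power-not-square : ∀ {p} → Prime p → ∀ {m} → p ∤ m → ∀ a x → p ^ suc (2 * a) * m ≢ x * x
odd-power-not-square {p} pp {m} p∤m a x eq
  with divides y refl ← reduce (euclidsLemma x x pp (subst (p ∣_) eq (∣m⇒∣m*n m (m∣m*n (p ^ (2 * a))))))
  = descend a (*-cancelˡ-≡ _ _ p (trans (trans (sym (*-assoc p _ m)) eq) (rearrange y p)))
  where
  instance _ = prime⇒nonZero pp
  rearrange : ∀ y p → y * p * (y * p) ≡ p * (p * (y * y))
  rearrange = solve-∀
  descend : ∀ a → p ^ (2 * a) * m ≢ p * (y * y)
  descend zero    eq = p∤m (subst (p ∣_) (trans (sym eq) (*-identityˡ m)) (m∣m*n (y * y)))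
  descend (suc a) eq = odd-power-not-square pp p∤m a y (*-cancelˡ-≡ _ _ p (begin
    p * (p ^ suc (2 * a) * m)   ≡⟨ *-assoc p _ m ⟨
    p ^ suc (suc (2 * a)) * m   ≡⟨ cong (λ e → p ^ e * m) (*-suc 2 a) ⟨
    p ^ (2 * suc a) * m         ≡⟨ eq ⟩
    p * (y * y)                 ∎))
    where open ≡-Reasoning

-- The arithmetic progression of the theorem.

quotient≡ : ∀ {z} m → z ≡ 1 + 24 * m → (z ∸ 1) / 24 ≡ m
quotient≡ m refl = trans (cong (_/ 24) (*-comm 24 m)) (m*n/n≡m m 24)

module _ {p} (pp : Prime p) (5≤p : 5 ≤ p) (a n i : ℕ) where

  -- Here α is `suc a`, so that 2α - 1 is `suc (2 * a)`.
  argument : ℕ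
  argument = p ^ (2 * suc a) * n + ((24 * i + p) * p ^ (2 * suc a ∸ 1) ∸ 1) / 24

  24*argument+1 : 24 * argument + 1 ≡ p ^ suc (2 * a) * (24 * (p * n + i) + p)
  24*argument+1 = begin
    24 * argument + 1
      ≡⟨ cong (λ z → 24 * z + 1) argument≡ ⟩
    24 * (p * P * n + (i * P + k)) + 1
      ≡⟨ expand p P n i k ⟩
    P * (24 * (p * n + i)) + (1 + 24 * k)
      ≡⟨ cong (P * (24 * (p * n + i)) +_) (trans p^ (*-comm p P)) ⟩
    P * (24 * (p * n + i)) + P * p
      ≡⟨ *-distribˡ-+ P _ p ⟨
    P * (24 * (p * n + i) + p) ∎
    where
    open ≡-Reasoning
    k P : ℕ
    -- This is (p ^ 2α - 1) / 24.
    k = proj₁ (even-power≡1[24] pp 5≤p (suc a))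
    P = p ^ suc (2 * a)
    2a+2 : 2 * suc a ≡ suc (suc (2 * a))
    2a+2 = *-suc 2 a
    p^ : 1 + 24 * k ≡ p * P
    p^ = trans (sym (proj₂ (even-power≡1[24] pp 5≤p (suc a)))) (cong (p ^_) 2a+2)
    split : ∀ i p P → (24 * i + p) * P ≡ p * P + 24 * (i * P)
    split = solve-∀
    regroup : ∀ k z → 1 + 24 * k + 24 * z ≡ 1 + 24 * (z + k)
    regroup = solve-∀
    numerator : (24 * i + p) * p ^ (2 * suc a ∸ 1) ≡ 1 + 24 * (i * P + k)
    numerator = begin
      (24 * i + p) * p ^ (2 * suc a ∸ 1) ≡⟨ cong (λ e → (24 * i + p) * p ^ (e ∸ 1)) 2a+2 ⟩
      (24 * i + p) * P                   ≡⟨ split i p P ⟩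
      p * P + 24 * (i * P)               ≡⟨ cong (_+ 24 * (i * P)) p^ ⟨
      1 + 24 * k + 24 * (i * P)          ≡⟨ regroup k (i * P) ⟩
      1 + 24 * (i * P + k)               ∎
    argument≡ : argument ≡ p * P * n + (i * P + k)
    argument≡ = cong₂ (λ e z → p ^ e * n + z) 2a+2 (quotient≡ (i * P + k) numerator)
    expand : ∀ p P n i k → 24 * (p * P * n + (i * P + k)) + 1 ≡ P * (24 * (p * n + i)) + (1 + 24 * k)
    expand = solve-∀

  -- Modulo p the cofactor of p ^ (2α - 1) is 24 i, and p divides neither 24 nor i, as 0 < i < p.
  argument-not-square : 1 ≤ i → i < p → ∀ x → 24 * argument + 1 ≢ x * x
  argument-not-square 1≤i i<p x eq =
    odd-power-not-square pp p∤cofactor a x (trans (sym 24*argument+1) eq)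
    where
    p∤i : p ∤ i
    p∤i p∣i = <⇒≱ i<p (∣⇒≤ {{>-nonZero 1≤i}} p∣i)
    p∤cofactor : p ∤ 24 * (p * n + i) + p
    p∤cofactor p∣ with euclidsLemma 24 (p * n + i) pp
                         (∣m+n∣m⇒∣n (subst (p ∣_) (+-comm _ p) p∣) ∣-refl)
    ... | inj₁ p∣24 = ∤24 pp 5≤p p∣24
    ... | inj₂ p∣   = p∤i (∣m+n∣m⇒∣n p∣ (m∣m*n n))

theorem3p2 : ∀ (p : ℕ) → Prime p → 5 ≤ p → ∀ (α : ℕ) → 1 ≤ α → ∀ (n : ℕ) →
    ∀ (i : ℕ) → 1 ≤ i → i < p →
    2 ∣ b 2 (p ^ (2 * α) * n + ((24 * i + p) * p ^ (2 * α ∸ 1) ∸ 1) / 24)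
theorem3p2 p pp 5≤p (suc a) _ n i 1≤i i<p =
  2∣b₂ (argument pp 5≤p a n i) (argument-not-square pp 5≤p a n i 1≤i i<p)
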